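{- Let $I$ and $M$ be sets with a distinguished element $m_0\in M$. Two $(I,M)$-systems $P$ and $Q$ are bisimilar (i.e. there exists a bisimulation between them) if and only if they are logically equivalent.
   Context: An $(I,M)$-system is a tuple $(A,\alpha_0,\lambda,\{\ltimes_i\}_{i\in I})$ where $A$ is a set with distinguished element $\alpha_0\in A$, $\lambda:A\to M$ is a function with $\lambda(\alpha_0)=m_0$, and $\ltimes_i\subseteq A\times A$ is a relation for each $i\in I$. A bisimulation between $(I,M)$-systems $(A,\alpha_0,\lambda^A,\{\ltimes_i^A\})$ and $(B,\beta_0,\lambda^B,\{\ltimes_i^B\})$ is a relation $\mathfrak R\subseteq A\times B$ such that, for all $\alpha,\alpha'\in A$, $\beta,\beta'\in B$, $i\in I$: (1) $\alpha_0\mathfrak R\beta_0$; (2) $\alpha\mathfrak R\beta$ implies $\lambda^A(\alpha)=\lambda^B(\beta)$; (3) if $\alpha\mathfrak R\beta$ and $\alpha\ltimes_i^A\alpha'$ then there is $\beta'$ with $\alpha'\mathfrak R\beta'$ and $\beta\ltimes_i^B\beta'$; (4) if $\alpha\mathfrak R\beta$ and $\beta\ltimes_i^B\beta'$ then there is $\alpha'$ with $\alpha'\mathfrak R\beta'$ and $\alpha\ltimes_i^A\alpha'$. The $(I,M)$-formulas are generated by $F::=\top\mid\lnot F\mid\bigwedge_{j\in J}F_j\mid\Lambda m\mid\langle i\rangle F$ with $m\in M$, $i\in I$, and $J$ an arbitrary index set. Satisfaction for an element $\alpha$ of an $(I,M)$-system: $\alpha\models\top$ always; $\alpha\models\lnot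 F$ iff not $\alpha\models F$; $\alpha\models\bigwedge_{j\in J}F_j$ iff $\alpha\models F_j$ for all $j\in J$; $\alpha\models\Lambda m$ iff $\lambda(\alpha)=m$; $\alpha\models\langle i\rangle F$ iff there is $\beta$ in the system with $\alpha\ltimes_i\beta$ and $\beta\models F$. Two $(I,M)$-systems are logically equivalent if their distinguished elements satisfy the same $(I,M)$-formulas. -}

module Defs where

open import Level using (Level; suc)
open import Data.Product using (_×_; ∃-syntax)
open import Data.Unit.Polymorphic using (⊤)
open import Function.Bundles using (_⇔_)
open import Relation.Binary.Core using (Rel; REL)
open import Relation.Binary.PropositionalEquality using (_≡_)
open import Relation.Nullary using (¬_)

-- A "set" is a type in one fixed, arbitrary universe Set ℓ.  This includes the
-- carriers of systems, the values of the relations, and the index sets J of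
-- infinitary conjunctions; the formulas themselves thus form a large type,
-- just as they form a proper class in set theory.

record System {ℓ : Level} (I M : Set ℓ) (m₀ : M) : Set (suc ℓ) where
  field
    Carrier    : Set ℓ
    root       : Carrier
    label      : Carrier → M
    label-root : label root ≡ m₀
    step       : I → Rel Carrier ℓ

  infix 4 _⋉[_]_
  _⋉[_]_ : Carrier → I → Carrier → Set ℓ
  α ⋉[ i ] β = step i α β

data Formula {ℓ : Level} (I M : Set ℓ) : Set (suc ℓ) where
  `⊤    : Formula I M
  `¬_   : Formula I M → Formula I M
  `⋀    : (J : Set ℓ) → (J → Formula I M) → Formula I M
  `Λ    : M → Formula I M
  `⟨_⟩_ : I → Formula I M → Formula I M

module _ {ℓ : Level} {I M : Set ℓ} {m₀ : M} where

  open System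

  record IsBisimulation (P Q : System I M m₀)
                        (R : REL (Carrier P) (Carrier Q) ℓ) : Set ℓ where
    open System P using () renaming (_⋉[_]_ to _⋉P[_]_)
    open System Q using () renaming (_⋉[_]_ to _⋉Q[_]_)
    field
      roots  : R (root P) (root Q)
      labels : ∀ {α β} → R α β → label P α ≡ label Q β
      forth  : ∀ {α α′ β i} → R α β → α ⋉P[ i ] α′ →
               ∃[ β′ ] R α′ β′ × β ⋉Q[ i ] β′
      back   : ∀ {α β β′ i} → R α β → β ⋉Q[ i ] β′ →
               ∃[ α′ ] R α′ β′ × α ⋉P[ i ] α′

  Bisimilar : System I M m₀ → System I M m₀ → Set (suc ℓ)
  Bisimilar P Q = ∃[ R ] IsBisimulation P Q R

  infix 4 _,_⊨_
  _,_⊨_ : (P : System I M m₀) → Carrier P → Formula I M → Set ℓ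
  P , α ⊨ `⊤         = ⊤
  P , α ⊨ (`¬ F)     = ¬ (P , α ⊨ F)
  P , α ⊨ `⋀ J F     = (j : J) → P , α ⊨ F j
  P , α ⊨ `Λ m       = label P α ≡ m
  P , α ⊨ (`⟨ i ⟩ F) = ∃[ β ] step P i α β × (P , β ⊨ F)

  LogicallyEquivalent : System I M m₀ → System I M m₀ → Set (suc ℓ)
  LogicallyEquivalent P Q = ∀ F → (P , root P ⊨ F) ⇔ (Q , root Q ⊨ F)

{-# OPTIONS --safe #-}

-- Bisimilar elements satisfy the same formulas by induction on the formula.
-- Conversely, the relation "no formula holds at α and fails at β" is a
-- bisimulation (Hennessy–Milner): if α ⋉ᵢ α′ and every i-successor β′ of β
-- were separated from α′ by a formula F β′, then ⟨i⟩ ⋀ F would separate α from β.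

module Submission where

open import Level using (Level; suc; Lift; lift; lower)
open import Axiom.ExcludedMiddle using (ExcludedMiddle)
open import Data.Product using (_×_; _,_; proj₁; proj₂; ∃-syntax; map₁; map₂)
open import Function.Base using (_∘_)
open import Function.Bundles using (_⇔_; mk⇔; Equivalence)
open import Relation.Binary.Core using (REL)
open import Relation.Binary.PropositionalEquality using (_≡_; refl; sym; trans)
open import Relation.Nullary using (¬_)
open import Relation.Nullary.Decidable
  using (decidable-stable; False; toWitnessFalse; fromWitnessFalse; map′)
open import Defs

open System using (Carrier; root; label; step)

private
  variable
    ℓ : Level
    I M : Set ℓ
    m₀ : M

module _ {I M : Set ℓ} {m₀ : M} {P Q : System I M m₀}
         {R : REL (Carrier P) (Carrier Q) ℓ} (bisim : IsBisimulation P Q R) where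

  open IsBisimulation bisim

  mutual
    -- Negation reverses the direction of transfer, so both directions go through one simultaneous
    -- induction on the formula.
    ⊨-forth : ∀ F {α β} → R α β → P , α ⊨ F → Q , β ⊨ F
    ⊨-forth `⊤        r s = s
    ⊨-forth (`¬ F)    r s = s ∘ ⊨-back F r
    ⊨-forth (`⋀ J F)  r s = λ j → ⊨-forth (F j) r (s j)
    ⊨-forth (`Λ m)    r s = trans (sym (labels r)) s
    ⊨-forth (`⟨ i ⟩ F) r (_ , t , s) with forth r t
    ... | β′ , r′ , t′ = β′ , t′ , ⊨-forth F r′ s

    ⊨-back : ∀ F {α β} → R α β → Q , β ⊨ F → P , α ⊨ F
    ⊨-back `⊤        r s = s
    ⊨-back (`¬ F)    r s = s ∘ ⊨-forth F r
    ⊨-back (`⋀ J F)  r s = λ j → ⊨-back (F j) r (s j)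
    ⊨-back (`Λ m)    r s = trans (labels r) s
    ⊨-back (`⟨ i ⟩ F) r (_ , t , s) with back r t
    ... | α′ , r′ , t′ = α′ , t′ , ⊨-back F r′ s

Bisimilar⇒LogicallyEquivalent : {P Q : System I M m₀} →
  Bisimilar P Q → LogicallyEquivalent P Q
Bisimilar⇒LogicallyEquivalent (_ , bisim) F =
  mk⇔ (⊨-forth bisim F roots) (⊨-back bisim F roots)
  where open IsBisimulation bisim

Separated : {I M : Set ℓ} {m₀ : M} (P Q : System I M m₀) →
  Carrier P → Carrier Q → Set (suc ℓ)
Separated P Q α β = ∃[ F ] (P , α ⊨ F) × ¬ (Q , β ⊨ F)

-- Negating the separating formula swaps the two sides; this is what makes inseparability symmetric.
Separated-sym : {P Q : System I M m₀} {α : Carrier P} {β : Carrier Q} →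
  Separated P Q α β → Separated Q P β α
Separated-sym (F , s , ¬s) = `¬ F , ¬s , λ ¬t → ¬t s

module _ {ℓ : Level} (em : ExcludedMiddle (suc ℓ)) where

  em-lower : ExcludedMiddle ℓ
  em-lower = map′ lower lift (em {Lift (suc ℓ) _})

  module _ {I M : Set ℓ} {m₀ : M} where

    -- Separated lives in Set (suc ℓ), but a bisimulation is valued in Set ℓ;
    -- excluded middle resizes it.
    Inseparable : (P Q : System I M m₀) → REL (Carrier P) (Carrier Q) ℓ
    Inseparable P Q α β = Lift ℓ (False (em {Separated P Q α β}))

    Inseparable⇒¬Separated : {P Q : System I M m₀} {α : Carrier P}
      {β : Carrier Q} → Inseparable P Q α β → ¬ Separated P Q α β
    Inseparable⇒¬Separated (lift w) = toWitnessFalse w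

    ¬Separated⇒Inseparable : {P Q : System I M m₀} {α : Carrier P}
      {β : Carrier Q} → ¬ Separated P Q α β → Inseparable P Q α β
    ¬Separated⇒Inseparable ¬sep = lift (fromWitnessFalse ¬sep)

    Inseparable-sym : {P Q : System I M m₀} {α : Carrier P} {β : Carrier Q} →
      Inseparable P Q α β → Inseparable Q P β α
    Inseparable-sym {P} {Q} r = ¬Separated⇒Inseparable
      (Inseparable⇒¬Separated r ∘ Separated-sym {P = Q} {Q = P})

    Inseparable-labels : (P Q : System I M m₀) {α : Carrier P} {β : Carrier Q} →
      Inseparable P Q α β → label P α ≡ label Q β
    Inseparable-labels P Q {α} r = decidable-stable em-lower
      -- The formula naming the label of `α` holds at `α` trivially, and at `β` only if the labels
      -- agree.
      λ ≢ → Inseparable⇒¬Separated r (`Λ (label P α) , refl , ≢ ∘ sym)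

    Inseparable-forth : (P Q : System I M m₀) {α α′ : Carrier P} {β : Carrier Q}
      {i : I} → Inseparable P Q α β → step P i α α′ →
      ∃[ β′ ] Inseparable P Q α′ β′ × step Q i β β′
    Inseparable-forth P Q {α} {α′} {β} {i} r t = decidable-stable em-lower
      λ none →
        let
          -- Decidability of the untruncated Σ-type Separated makes this a
          -- choice of one separating formula per successor of β.
          separate : ((β′ , _) : ∃[ β′ ] step Q i β β′) → Separated P Q α′ β′
          separate (β′ , u) = decidable-stable em
            λ ¬sep → none (β′ , ¬Separated⇒Inseparable ¬sep , u)
        in Inseparable⇒¬Separated r
          -- Indexing by the `i`-successors of `β` keeps the conjunction's index set in `Set ℓ`,
          -- although formulas form a larger type. With no successors the conjunction is empty, and
          -- the diamond still fails at `β`.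
          ( `⟨ i ⟩ `⋀ (∃[ β′ ] step Q i β β′) (proj₁ ∘ separate)
          , (α′ , t , proj₁ ∘ proj₂ ∘ separate)
          -- A successor satisfying the whole conjunction would satisfy the conjunct chosen to fail
          -- at it.
          , λ (β′ , u , s) → proj₂ (proj₂ (separate (β′ , u))) (s (β′ , u)))

    Inseparable-isBisimulation : (P Q : System I M m₀) →
      LogicallyEquivalent P Q → IsBisimulation P Q (Inseparable P Q)
    Inseparable-isBisimulation P Q P≈Q = record
      { roots  = ¬Separated⇒Inseparable
                   λ (F , s , ¬s) → ¬s (Equivalence.to (P≈Q F) s)
      ; labels = Inseparable-labels P Q
      ; forth  = Inseparable-forth P Q
      -- By symmetry this is the forth condition with `P` and `Q` exchanged.
      ; back   = λ r t → map₂ (map₁ Inseparable-sym)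
                   (Inseparable-forth Q P (Inseparable-sym r) t)
      }

theorem6p7 : ∀ {ℓ : Level} → ExcludedMiddle (suc ℓ) →
    (I M : Set ℓ) (m₀ : M) (P Q : System I M m₀) →
    Bisimilar P Q ⇔ LogicallyEquivalent P Q
theorem6p7 em I M m₀ P Q = mk⇔
  Bisimilar⇒LogicallyEquivalent
  (λ P≈Q → Inseparable em P Q , Inseparable-isBisimulation em P Q P≈Q)
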